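{- Let $\alpha_i\ge 0$, $\beta_i>0$ ($1\le i\le 5$) and $Q>0$ be real numbers, and consider the networks $N$ and $N^+$ with these parameters and total flow $Q$. Suppose that at equilibria $N$ has no path with vanishing flow and $P_3$ is the only path with non-vanishing flow in $N^+$. Then Braess' paradox occurs in $N/N^+$ (i.e. $T^+_{Eq}>T_{Eq}$) if and only if $\mathcal B_2>0$ and $$\max\left\{\frac{\alpha}{\beta_{12}},\ \frac{ -\alpha}{\beta_{45}},\ \frac{\hat\alpha\beta_{45}+\bar\alpha\beta_{12}}{\mathcal B_2}\right\} < Q \le \min\left\{\frac{\hat\alpha}{\beta_{35}},\ \frac{\bar\alpha}{\beta_{13}}\right\}.$$
   Context: The network $N^+$ has nodes $a,b,c,d$ and directed links $(a,b),(b,d),(b,c),(a,c),(c,d)$ with travel times $\alpha_1+\beta_1f_{ab}$, $\alpha_2+\beta_2f_{bd}$, $\alpha_3+\beta_3f_{bc}$, $\alpha_4+\beta_4f_{ac}$, $\alpha_5+\beta_5f_{cd}$ respectively, where $f_{ij}\ge 0$ is the (real) flow on link $(i,j)$ and $\alpha_i\ge 0$, $\beta_i>0$. All traffic, of total amount $Q>0$ (real), goes from $a$ to $d$ along the paths $P_1=a-b-d$, $P_2=a-c-d$, $P_3=a-b-c-d$. The network $N$ is $N^+$ with the link $(b,c)$ removed, so its paths are $P_1,P_2$ only. A flow assigns a non-negative real amount to each path, with total $Q$; the flow on a link is the sum of the flows of the paths containing it; the travel time on a path is the sum of the travel times of its links. A path has vanishing flow if its path flow is $0$, and non-vanishing flow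 otherwise. A network is at equilibrium if all paths with non-vanishing flow have the same travel time, and every path with vanishing flow has travel time at least this common value. The equilibrium exists and is unique; its common travel time is denoted $T_{Eq}$ for $N$ and $T^+_{Eq}$ for $N^+$. Braess' paradox is said to occur in $N/N^+$ for the total flow $Q$ if $T^+_{Eq}>T_{Eq}$. Notation: multiple indices denote sums, e.g. $\alpha_{ij}=\alpha_i+\alpha_j$, $\beta_{135}=\beta_1+\beta_3+\beta_5$. Further, $\alpha=\alpha_{45}-\alpha_{12}$, $\bar\alpha=\alpha_4-\alpha_{13}$, $\hat\alpha=\alpha_2-\alpha_{35}$, $\beta=\beta_1+\beta_2+\beta_4+\beta_5$, and $\mathcal B_2=\beta_{135}\beta-\beta_{12}\beta_{45}$. -}

module Defs where

open import Level using (suc; _⊔_)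
open import Algebra.Apartness.Bundles using (HeytingField)
import Algebra.Definitions.RawMonoid as RawMonoidDefs
open import Algebra.Bundles using (RawMonoid)
open import Data.Fin.Base using (Fin)
open import Data.Fin.Patterns using (0F; 1F; 2F; 3F; 4F)
import Data.Fin.Properties as Fin
open import Data.List.Base using (List; []; _∷_; map; foldr; filter)
open import Data.List.Membership.DecPropositional using () renaming (_∈?_ to member?)
open import Data.Nat.Base using (ℕ) renaming (_≤_ to _≤ℕ_)
open import Data.Product.Base using (∃-syntax; _×_; _,_; proj₁; proj₂)
open import Data.Sum.Base using (_⊎_; inj₂)
open import Function.Bundles using (_⇔_; Equivalence; mk↣)
open import Relation.Binary.Core using (Rel)
open import Relation.Binary.Definitions using (DecidableEquality)
open import Relation.Binary.Lattice.Definitions using (Supremum; Infimum)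
open import Relation.Binary.PropositionalEquality using (_≡_; refl)
open import Relation.Binary.Structures using (IsStrictPartialOrder)
open import Relation.Nullary.Decidable using (via-injection)
open import Relation.Nullary.Negation using (¬_)

-- The real numbers, characterised (up to isomorphism, classically) as the
-- Cauchy-complete Archimedean ordered field.  No trichotomy is assumed, so that
-- the usual constructive real numbers are a model as well.  Linearity of the
-- order takes the form of the cotransitivity of _#_, which is part of
-- HeytingField; max and min are fields because they cannot be defined by cases.
record Reals c ℓ₁ ℓ₂ : Set (suc (c ⊔ ℓ₁ ⊔ ℓ₂)) where
  field
    heytingField : HeytingField c ℓ₁ ℓ₂

  open HeytingField heytingField public

  infix 4 _<_ _≤_

  field
    _<_                  : Rel Carrier ℓ₂
    isStrictPartialOrder : IsStrictPartialOrder _≈_ _<_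
    #⇔<⊎>                : ∀ {x y} → (x # y) ⇔ (x < y ⊎ y < x)
    +-monoˡ-<            : ∀ {x y} z → x < y → x + z < y + z
    *-pos                : ∀ {x y} → 0# < x → 0# < y → 0# < x * y

  open IsStrictPartialOrder isStrictPartialOrder public
    using (<-resp-≈; <-respˡ-≈; <-respʳ-≈)
    renaming (irrefl to <-irrefl; trans to <-trans; asym to <-asym)

  _≤_ : Rel Carrier ℓ₂
  x ≤ y = ¬ (y < x)

  field
    max          : Carrier → Carrier → Carrier
    min          : Carrier → Carrier → Carrier
    max-supremum : Supremum _≤_ max
    min-infimum  : Infimum _≤_ min

  ∣_∣ : Carrier → Carrier
  ∣ x ∣ = max x (- x)

  +-rawMonoid : RawMonoid c ℓ₁
  +-rawMonoid = record { _≈_ = _≈_ ; _∙_ = _+_ ; ε = 0# }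

  open RawMonoidDefs +-rawMonoid using () renaming (_×_ to _·ℕ_)

  IsCauchy : (ℕ → Carrier) → Set (c ⊔ ℓ₂)
  IsCauchy u = ∀ ε → 0# < ε →
    ∃[ k ] (∀ m n → k ≤ℕ m → k ≤ℕ n → ∣ u m - u n ∣ < ε)

  _ConvergesTo_ : (ℕ → Carrier) → Carrier → Set (c ⊔ ℓ₂)
  u ConvergesTo l = ∀ ε → 0# < ε →
    ∃[ k ] (∀ n → k ≤ℕ n → ∣ u n - l ∣ < ε)

  field
    archimedean : ∀ x → ∃[ n ] (x < n ·ℕ 1#)
    complete    : ∀ u → IsCauchy u → ∃[ l ] (u ConvergesTo l)

  +-pos : ∀ {x y} → 0# < x → 0# < y → 0# < x + y
  +-pos {x} {y} 0<x 0<y =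
    <-trans 0<y (<-respˡ-≈ (+-identityˡ y) (+-monoˡ-< y 0<x))

  infix 8 _⁻¹⟨_⟩
  infixl 7 _/_⟨_⟩

  _⁻¹⟨_⟩ : ∀ y → 0# < y → Carrier
  -- #⇒invertible yields an inverse of y - 0#.
  y ⁻¹⟨ 0<y ⟩ = proj₁ (#⇒invertible {y} {0#} (Equivalence.from #⇔<⊎> (inj₂ 0<y)))

  _/_⟨_⟩ : Carrier → ∀ y → 0# < y → Carrier
  x / y ⟨ 0<y ⟩ = x * y ⁻¹⟨ 0<y ⟩

-- The links (a,b), (b,d), (b,c), (a,c), (c,d), in the order 1, …, 5 of the
-- indices of their coefficients.
data Link : Set where
  ab bd bc ac cd : Link

index : Link → Fin 5
index ab = 0F
index bd = 1F
index bc = 2F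
index ac = 3F
index cd = 4F

index-injective : ∀ {k l} → index k ≡ index l → k ≡ l
index-injective {ab} {ab} refl = refl
index-injective {bd} {bd} refl = refl
index-injective {bc} {bc} refl = refl
index-injective {ac} {ac} refl = refl
index-injective {cd} {cd} refl = refl

_≟_ : DecidableEquality Link
_≟_ = via-injection (mk↣ index-injective) Fin._≟_

data Network : Set where
  N N⁺ : Network

data Path : Network → Set where
  P₁ P₂ : ∀ {n} → Path n
  P₃    : Path N⁺

paths : ∀ n → List (Path n)
paths N  = P₁ ∷ P₂ ∷ []
paths N⁺ = P₁ ∷ P₂ ∷ P₃ ∷ []

links : ∀ {n} → Path n → List Link
links P₁ = ab ∷ bd ∷ []
links P₂ = ac ∷ cd ∷ []
links P₃ = ab ∷ bc ∷ cd ∷ []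

module Traffic {c ℓ₁ ℓ₂} (ℝ : Reals c ℓ₁ ℓ₂) where
  open Reals ℝ

  sum : List Carrier → Carrier
  sum = foldr _+_ 0#

  record Flow (n : Network) (Q : Carrier) : Set (c ⊔ ℓ₁ ⊔ ℓ₂) where
    field
      amount  : Path n → Carrier
      nonNeg  : ∀ p → 0# ≤ amount p
      total   : sum (map amount (paths n)) ≈ Q

    linkFlow : Link → Carrier
    linkFlow l =
      sum (map amount (filter (λ p → member? _≟_ l (links p)) (paths n)))

    Vanishing : Path n → Set ℓ₁
    Vanishing p = amount p ≈ 0#

    -- Apartness is the constructive form of "≠"; it is equivalent to
    -- ¬ Vanishing p as soon as the order is decidable.
    NonVanishing : Path n → Set ℓ₂
    NonVanishing p = amount p # 0#

  module Times (αᵢ βᵢ : Link → Carrier) where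

    module _ {n Q} (f : Flow n Q) where
      open Flow f

      linkTime : Link → Carrier
      linkTime l = αᵢ l + βᵢ l * linkFlow l

      pathTime : Path n → Carrier
      pathTime p = sum (map linkTime (links p))

      -- f is an equilibrium whose common travel time is T.
      IsEquilibrium : Carrier → Set (ℓ₁ ⊔ ℓ₂)
      IsEquilibrium T =
          (∀ p → NonVanishing p → pathTime p ≈ T)
        × (∀ p → Vanishing p → T ≤ pathTime p)

    α ᾱ α̂ : Carrier
    α = (αᵢ ac + αᵢ cd) - (αᵢ ab + αᵢ bd)
    ᾱ = αᵢ ac - (αᵢ ab + αᵢ bc)
    α̂ = αᵢ bd - (αᵢ bc + αᵢ cd)

    β₁₂ β₄₅ β₁₃ β₃₅ β₁₃₅ β ℬ₂ : Carrier
    β₁₂  = βᵢ ab + βᵢ bd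
    β₄₅  = βᵢ ac + βᵢ cd
    β₁₃  = βᵢ ab + βᵢ bc
    β₃₅  = βᵢ bc + βᵢ cd
    β₁₃₅ = βᵢ ab + βᵢ bc + βᵢ cd
    β    = βᵢ ab + βᵢ bd + βᵢ ac + βᵢ cd
    ℬ₂   = β₁₃₅ * β - β₁₂ * β₄₅

    module Positivity (βᵢ>0 : ∀ l → 0# < βᵢ l) where

      β₁₂>0 : 0# < β₁₂
      β₁₂>0 = +-pos (βᵢ>0 ab) (βᵢ>0 bd)

      β₄₅>0 : 0# < β₄₅
      β₄₅>0 = +-pos (βᵢ>0 ac) (βᵢ>0 cd)

      β₁₃>0 : 0# < β₁₃
      β₁₃>0 = +-pos (βᵢ>0 ab) (βᵢ>0 bc)

      β₃₅>0 : 0# < β₃₅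
      β₃₅>0 = +-pos (βᵢ>0 bc) (βᵢ>0 cd)

{-# OPTIONS --safe #-}
module Submission where

open import Defs
open import Algebra.Apartness.Bundles using (HeytingField; HeytingCommutativeRing)
open import Algebra.Bundles using (CommutativeRing)
import Algebra.Apartness.Properties.HeytingCommutativeRing as HeytingProperties
import Algebra.Properties.Ring as RingProperties
import Algebra.Solver.Ring.NaturalCoefficients.Default as SemiringSolver
open import Data.Empty using (⊥-elim)
open import Data.Product.Base using (Σ-syntax; _×_; _,_; proj₁; proj₂)
open import Data.Sum.Base using (_⊎_; inj₁; inj₂)
open import Function.Base using (_∘_)
open import Function.Bundles using (_⇔_; Equivalence; mk⇔)
import Relation.Binary.Reasoning.Setoid as SetoidReasoning

-- Solving N for its common travel time T, and reading off T⁺ = α₁₃₅ + β₁₃₅ Q, gives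
--   β (T⁺ - T) = ℬ₂ Q - (α̂ β₄₅ + ᾱ β₁₂).
-- Hence T < T⁺ iff α̂ β₄₅ + ᾱ β₁₂ < ℬ₂ Q.  The other bounds on Q hold automatically:
-- the first two lower bounds say that both path flows of N are positive, and the
-- upper bounds say that P₁ and P₂ are not faster than P₃ in N⁺.  The upper bounds
-- make α̂ and ᾱ positive, so the paradox forces ℬ₂ Q, hence ℬ₂, to be positive.

-- Order and division in an ordered field without trichotomy.

module OrderedField {c ℓ₁ ℓ₂} (ℝ : Reals c ℓ₁ ℓ₂) where
  open Reals ℝ

  commutativeRing : CommutativeRing c ℓ₁
  commutativeRing = HeytingCommutativeRing.commutativeRing
    (HeytingField.heytingCommutativeRing heytingField)

  open HeytingProperties (HeytingField.heytingCommutativeRing heytingField)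
    using (1#0; x-0≈x; invertibleˡ⇒#)
  open RingProperties (CommutativeRing.ring commutativeRing) public
    using (-‿distribʳ-*; -‿involutive; ⁻¹-anti-homo‿-)
    renaming (//-rightDividesˡ to x-y+y≈x; //-rightDividesʳ to x+y-y≈x)

  private variable
    u v x y z : Carrier

  <⇒# : x < y → x # y
  <⇒# = Equivalence.from #⇔<⊎> ∘ inj₁

  -- Takes the place of trichotomy. Cotransitivity of `_#_` separates `z` from `x` or from `y`; if
  -- the order then points the wrong way, transitivity gives the other alternative.
  <-cotrans : x < y → ∀ z → x < z ⊎ z < y
  <-cotrans x<y z with #-cotrans (<⇒# x<y) z
  ... | inj₁ x#z with Equivalence.to #⇔<⊎> x#z
  ...   | inj₁ x<z = inj₁ x<z
  ...   | inj₂ z<x = inj₂ (<-trans z<x x<y)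
  <-cotrans x<y z | inj₂ z#y with Equivalence.to #⇔<⊎> z#y
  ...   | inj₁ z<y = inj₂ z<y
  ...   | inj₂ y<z = inj₁ (<-trans x<y y<z)

  <⇒≤ : x < y → x ≤ y
  <⇒≤ x<y y<x = <-asym x<y y<x

  -- Since `x ≤ y` is only a negation, the strict inequality comes from locating `x` relative to
  -- `y < z`; the case `y < x` is excluded.
  ≤-<-trans : x ≤ y → y < z → x < z
  ≤-<-trans {x} x≤y y<z with <-cotrans y<z x
  ... | inj₁ y<x = ⊥-elim (x≤y y<x)
  ... | inj₂ x<z = x<z

  <-≤-trans : x < y → y ≤ z → x < z
  <-≤-trans {z = z} x<y y≤z with <-cotrans x<y z
  ... | inj₁ x<z = x<z
  ... | inj₂ z<y = ⊥-elim (y≤z z<y)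

  ≤-refl : x ≤ x
  ≤-refl = <-irrefl refl

  ≤∧#⇒< : x ≤ y → y # x → x < y
  ≤∧#⇒< x≤y y#x with Equivalence.to #⇔<⊎> y#x
  ... | inj₁ y<x = ⊥-elim (x≤y y<x)
  ... | inj₂ x<y = x<y

  -- The supremum property only concerns `≤`, so cotransitivity is applied at the maximum. It
  -- remains to exclude a maximum strictly above both entries: leastness would force `v ≤ u`, and
  -- then `max u v ≤ u`.
  max-lub-< : u < z → v < z → max u v < z
  max-lub-< {u} {z} {v} u<z v<z with <-cotrans u<z (max u v) | <-cotrans v<z (max u v)
  ... | inj₂ m<z | _        = m<z
  ... | inj₁ _   | inj₂ m<z = m<z
  ... | inj₁ u<m | inj₁ v<m = ⊥-elim (least u ≤-refl v≤u u<m)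
    where
    least : ∀ w → u ≤ w → v ≤ w → max u v ≤ w
    least = proj₂ (proj₂ (max-supremum u v))

    v≤u : v ≤ u
    v≤u u<v = least v (<⇒≤ u<v) ≤-refl v<m

  +-cancelʳ-< : ∀ z → x + z < y + z → x < y
  +-cancelʳ-< {x} {y} z x+z<y+z =
    <-respʳ-≈ (x+y-y≈x z y) (<-respˡ-≈ (x+y-y≈x z x) (+-monoˡ-< (- z) x+z<y+z))

  0<y⇒x<x+y : 0# < y → x < x + y
  0<y⇒x<x+y {y} {x} 0<y =
    <-respʳ-≈ (+-comm y x) (<-respˡ-≈ (+-identityˡ x) (+-monoˡ-< x 0<y))

  x<y⇒0<y-x : x < y → 0# < y - x
  x<y⇒0<y-x {x} x<y = <-respˡ-≈ (-‿inverseʳ x) (+-monoˡ-< (- x) x<y)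

  x<z+y⇒x-y<z : x < z + y → x - y < z
  x<z+y⇒x-y<z {x} {z} {y} x<z+y = <-respʳ-≈ (x+y-y≈x y z) (+-monoˡ-< (- y) x<z+y)

  -- In equal sums, the excess of `y` over `x` is made up by that of `u` over `v`. This turns an
  -- identity of sums into an implication between strict inequalities.
  balance : x + u ≈ y + v → x < y → v < u
  balance {x} {u} {y} {v} x+u≈y+v x<y = +-cancelʳ-< x
    (<-respˡ-≈ (+-comm x v) (<-respʳ-≈ (trans (sym x+u≈y+v) (+-comm x u))
      (+-monoˡ-< v x<y)))

  *-monoʳ-< : 0# < z → x < y → x * z < y * z
  *-monoʳ-< {z} {x} {y} 0<z x<y =
    <-respʳ-≈ (trans (sym (distribʳ z (y - x) x)) (*-congʳ (x-y+y≈x x y)))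
      (<-respˡ-≈ (+-identityˡ (x * z))
        (+-monoˡ-< (x * z) (*-pos (x<y⇒0<y-x x<y) 0<z)))

  0<-x : x < 0# → 0# < - x
  0<-x {x} x<0 = <-respʳ-≈ (+-identityˡ (- x)) (x<y⇒0<y-x x<0)

  -- `1#` is apart from `0#`; if it were negative, `- 1#` and hence its square `1#` would be
  -- positive.
  0<1 : 0# < 1#
  0<1 with Equivalence.to #⇔<⊎> 1#0
  ... | inj₂ 0<1# = 0<1#
  ... | inj₁ 1<0  = ⊥-elim (<-asym 1<0
    (<-respʳ-≈ [-1]²≈1 (*-pos (0<-x 1<0) (0<-x 1<0))))
    where
    [-1]²≈1 : - 1# * - 1# ≈ 1#
    [-1]²≈1 = trans (sym (-‿distribʳ-* (- 1#) 1#))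
      (trans (-‿cong (*-identityʳ (- 1#))) (-‿involutive 1#))

  -- An invertible `y` is apart from `0#`, and a negative `y` would make `1#` negative.
  x*y≈1⇒0<y : 0# < x → x * y ≈ 1# → 0# < y
  x*y≈1⇒0<y {x} {y} 0<x x*y≈1
    with Equivalence.to #⇔<⊎> (invertibleˡ⇒# (x , trans (*-congˡ (x-0≈x y)) x*y≈1))
  ... | inj₂ 0<y = 0<y
  ... | inj₁ y<0 = ⊥-elim (<-asym 0<1 1<0)
    where
    1<0 : 1# < 0#
    1<0 = <-respˡ-≈ (trans (*-comm y x) x*y≈1)
      (<-respʳ-≈ (zeroˡ x) (*-monoʳ-< 0<x y<0))

  *-inverseʳ : ∀ (0<y : 0# < y) → y * y ⁻¹⟨ 0<y ⟩ ≈ 1#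
  *-inverseʳ {y} 0<y = trans (*-congʳ (sym (x-0≈x y)))
    (proj₂ (proj₂ (#⇒invertible {y} {0#} (Equivalence.from #⇔<⊎> (inj₂ 0<y)))))

  ⁻¹-pos : ∀ (0<y : 0# < y) → 0# < y ⁻¹⟨ 0<y ⟩
  ⁻¹-pos 0<y = x*y≈1⇒0<y 0<y (*-inverseʳ 0<y)

  [x*y]/y≈x : ∀ x (0<y : 0# < y) → (x * y) / y ⟨ 0<y ⟩ ≈ x
  [x*y]/y≈x x 0<y =
    trans (*-assoc x _ _) (trans (*-congˡ (*-inverseʳ 0<y)) (*-identityʳ x))

  [x/y]*y≈x : ∀ x (0<y : 0# < y) → x / y ⟨ 0<y ⟩ * y ≈ x
  [x/y]*y≈x {y} x 0<y = trans (*-assoc x _ y)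
    (trans (*-congˡ (trans (*-comm _ y) (*-inverseʳ 0<y))) (*-identityʳ x))

  *-cancelʳ-< : 0# < z → x * z < y * z → x < y
  *-cancelʳ-< {x = x} {y} 0<z x*z<y*z =
    <-respʳ-≈ ([x*y]/y≈x y 0<z) (<-respˡ-≈ ([x*y]/y≈x x 0<z)
      (*-monoʳ-< (⁻¹-pos 0<z) x*z<y*z))

  x<z*y⇒x/y<z : ∀ (0<y : 0# < y) → x < z * y → x / y ⟨ 0<y ⟩ < z
  x<z*y⇒x/y<z {x = x} 0<y x<z*y =
    *-cancelʳ-< 0<y (<-respˡ-≈ (sym ([x/y]*y≈x x 0<y)) x<z*y)

  x/y<z⇒x<z*y : ∀ (0<y : 0# < y) → x / y ⟨ 0<y ⟩ < z → x < z * y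
  x/y<z⇒x<z*y {x = x} 0<y x/y<z =
    <-respˡ-≈ ([x/y]*y≈x x 0<y) (*-monoʳ-< 0<y x/y<z)

  z*y≤x⇒z≤x/y : ∀ (0<y : 0# < y) → z * y ≤ x → z ≤ x / y ⟨ 0<y ⟩
  z*y≤x⇒z≤x/y 0<y z*y≤x x/y<z = z*y≤x (x/y<z⇒x<z*y 0<y x/y<z)

-- Travel times and the relations they satisfy at equilibrium.

module Equilibria {c ℓ₁ ℓ₂} (ℝ : Reals c ℓ₁ ℓ₂) where
  open Reals ℝ
  open Traffic ℝ
  open OrderedField ℝ
  open SemiringSolver (CommutativeRing.commutativeSemiring commutativeRing)
    using (solve; _:=_; _:+_; _:*_; con)
  open SetoidReasoning (CommutativeRing.setoid commutativeRing)

  -- Substituting `x = Q - y` gives `a′ - a = Q * b - (b + b′) * y`, and the subtracted term is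
  -- positive.
  balanced-loads-bound : ∀ {a b a′ b′ x y Q} → 0# < b → 0# < b′ → 0# < y → x + y ≈ Q →
                         a + b * x ≈ a′ + b′ * y → a′ - a < Q * b
  balanced-loads-bound {a} {b} {a′} {b′} {x} {y} {Q} 0<b 0<b′ 0<y x+y≈Q eq =
    x<z+y⇒x-y<z (<-respʳ-≈ sum≈ (0<y⇒x<x+y (*-pos (+-pos 0<b 0<b′) 0<y)))
    where
    sum≈ : a′ + (b + b′) * y ≈ Q * b + a
    sum≈ = begin
      a′ + (b + b′) * y
        ≈⟨ solve 4 (λ a b b′ y → a :+ (b :+ b′) :* y := (a :+ b′ :* y) :+ b :* y)
             refl a′ b b′ y ⟩
      a′ + b′ * y + b * y
        ≈⟨ +-congʳ eq ⟨
      a + b * x + b * y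
        ≈⟨ solve 4 (λ a b x y → a :+ b :* x :+ b :* y := (x :+ y) :* b :+ a)
             refl a b x y ⟩
      (x + y) * b + a
        ≈⟨ +-congʳ (*-congʳ x+y≈Q) ⟩
      Q * b + a ∎

  -- The times `t` and `p` share the part `a + b * Q`; cancelling it from `t ≤ p` leaves `Q * d`
  -- against `h`.
  slack-bound : ∀ {t p a b d s h Q} → t ≤ p → t ≈ a + s * Q → p ≈ h + a + b * Q →
                b + d ≈ s → Q * d ≤ h
  slack-bound {t} {p} {a} {b} {d} {s} {h} {Q} t≤p t≈ p≈ b+d≈s h<Qd =
    t≤p (<-respˡ-≈ h+≈p (<-respʳ-≈ Qd+≈t (+-monoˡ-< (a + b * Q) h<Qd)))
    where
    h+≈p : h + (a + b * Q) ≈ p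
    h+≈p = trans (sym (+-assoc h a (b * Q))) (sym p≈)

    Qd+≈t : Q * d + (a + b * Q) ≈ t
    Qd+≈t = begin
      Q * d + (a + b * Q)  ≈⟨ solve 4 (λ q d a b → q :* d :+ (a :+ b :* q)
                                                := a :+ (b :+ d) :* q) refl Q d a b ⟩
      a + (b + d) * Q      ≈⟨ +-congˡ (*-congʳ b+d≈s) ⟩
      a + s * Q            ≈⟨ t≈ ⟨
      t                    ∎

  module Links (αᵢ βᵢ : Link → Carrier) where
    open Times αᵢ βᵢ
    open Flow

    α₁₂ α₄₅ α₁₃₅ : Carrier
    α₁₂  = αᵢ ab + αᵢ bd
    α₄₅  = αᵢ ac + αᵢ cd
    α₁₃₅ = αᵢ ab + αᵢ bc + αᵢ cd

    module _ {Q} (f : Flow N Q) where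

      total-N : amount f P₁ + amount f P₂ ≈ Q
      total-N = trans (+-congˡ (sym (+-identityʳ (amount f P₂)))) (total f)

      pathTime-N-P₁ : pathTime f P₁ ≈ α₁₂ + β₁₂ * amount f P₁
      pathTime-N-P₁ = solve 5
        -- Each `con 0` is the empty tail of a list sum, in the link flows and in the path time.
        (λ a₁ b₁ a₂ b₂ x → (a₁ :+ b₁ :* (x :+ con 0)) :+
           ((a₂ :+ b₂ :* (x :+ con 0)) :+ con 0) := (a₁ :+ a₂) :+ (b₁ :+ b₂) :* x)
        refl (αᵢ ab) (βᵢ ab) (αᵢ bd) (βᵢ bd) (amount f P₁)

      pathTime-N-P₂ : pathTime f P₂ ≈ α₄₅ + β₄₅ * amount f P₂
      pathTime-N-P₂ = solve 5
        (λ a₁ b₁ a₂ b₂ x → (a₁ :+ b₁ :* (x :+ con 0)) :+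
           ((a₂ :+ b₂ :* (x :+ con 0)) :+ con 0) := (a₁ :+ a₂) :+ (b₁ :+ b₂) :* x)
        refl (αᵢ ac) (βᵢ ac) (αᵢ cd) (βᵢ cd) (amount f P₂)

    module _ {Q} (f⁺ : Flow N⁺ Q) (P₁≈0 : Vanishing f⁺ P₁) (P₂≈0 : Vanishing f⁺ P₂) where

      -- The trailing `0#` is kept because `linkFlow` computes to sums ending in exactly this term.
      amount-P₃ : amount f⁺ P₃ + 0# ≈ Q
      amount-P₃ = begin
        amount f⁺ P₃ + 0#
          ≈⟨ +-identityˡ _ ⟨
        0# + (amount f⁺ P₃ + 0#)
          ≈⟨ +-identityˡ _ ⟨
        0# + (0# + (amount f⁺ P₃ + 0#))
          ≈⟨ +-cong P₁≈0 (+-congʳ P₂≈0) ⟨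
        amount f⁺ P₁ + (amount f⁺ P₂ + (amount f⁺ P₃ + 0#))
          ≈⟨ total f⁺ ⟩
        Q ∎

      flow : Link → Carrier
      flow ab = Q
      flow bd = 0#
      flow bc = Q
      flow ac = 0#
      flow cd = Q

      linkFlow≈flow : ∀ l → linkFlow f⁺ l ≈ flow l
      linkFlow≈flow ab = trans (+-cong P₁≈0 amount-P₃) (+-identityˡ Q)
      linkFlow≈flow bd = trans (+-identityʳ _) P₁≈0
      linkFlow≈flow bc = amount-P₃
      linkFlow≈flow ac = trans (+-identityʳ _) P₂≈0
      linkFlow≈flow cd = trans (+-cong P₂≈0 amount-P₃) (+-identityˡ Q)

      linkTime≈ : ∀ l → linkTime f⁺ l ≈ αᵢ l + βᵢ l * flow l
      linkTime≈ l = +-congˡ (*-congˡ (linkFlow≈flow l))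

      pathTime-N⁺-P₁ : pathTime f⁺ P₁ ≈ α₁₂ + βᵢ ab * Q
      pathTime-N⁺-P₁ = trans (+-cong (linkTime≈ ab) (+-congʳ (linkTime≈ bd)))
        (solve 5 (λ a₁ b₁ a₂ b₂ q → (a₁ :+ b₁ :* q) :+ ((a₂ :+ b₂ :* con 0) :+ con 0)
            := (a₁ :+ a₂) :+ b₁ :* q)
          refl (αᵢ ab) (βᵢ ab) (αᵢ bd) (βᵢ bd) Q)

      pathTime-N⁺-P₂ : pathTime f⁺ P₂ ≈ α₄₅ + βᵢ cd * Q
      pathTime-N⁺-P₂ = trans (+-cong (linkTime≈ ac) (+-congʳ (linkTime≈ cd)))
        (solve 5 (λ a₁ b₁ a₂ b₂ q → (a₁ :+ b₁ :* con 0) :+ ((a₂ :+ b₂ :* q) :+ con 0)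
            := (a₁ :+ a₂) :+ b₂ :* q)
          refl (αᵢ ac) (βᵢ ac) (αᵢ cd) (βᵢ cd) Q)

      pathTime-N⁺-P₃ : pathTime f⁺ P₃ ≈ α₁₃₅ + β₁₃₅ * Q
      pathTime-N⁺-P₃ =
        trans (+-cong (linkTime≈ ab) (+-cong (linkTime≈ bc) (+-congʳ (linkTime≈ cd))))
        (solve 7 (λ a₁ b₁ a₂ b₂ a₃ b₃ q →
            (a₁ :+ b₁ :* q) :+ ((a₂ :+ b₂ :* q) :+ ((a₃ :+ b₃ :* q) :+ con 0))
            := (a₁ :+ a₂ :+ a₃) :+ (b₁ :+ b₂ :+ b₃) :* q)
          refl (αᵢ ab) (βᵢ ab) (αᵢ bc) (βᵢ bc) (αᵢ cd) (βᵢ cd) Q)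

    -- Splits off the constant part of the time on `P₃`, so that `α̂` enters the semiring identities
    -- as a single variable.
    α₁₂≈α̂+α₁₃₅ : α₁₂ ≈ α̂ + α₁₃₅
    α₁₂≈α̂+α₁₃₅ = trans (+-congˡ (sym (x-y+y≈x (αᵢ bc + αᵢ cd) (αᵢ bd))))
      (solve 4 (λ a₁ h a₃ a₅ → a₁ :+ (h :+ (a₃ :+ a₅)) := h :+ (a₁ :+ a₃ :+ a₅))
        refl (αᵢ ab) α̂ (αᵢ bc) (αᵢ cd))

    α₄₅≈ᾱ+α₁₃₅ : α₄₅ ≈ ᾱ + α₁₃₅
    α₄₅≈ᾱ+α₁₃₅ = trans (+-congʳ (sym (x-y+y≈x (αᵢ ab + αᵢ bc) (αᵢ ac))))
      (solve 4 (λ a₁ h a₃ a₅ → (h :+ (a₁ :+ a₃)) :+ a₅ := h :+ (a₁ :+ a₃ :+ a₅))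
        refl (αᵢ ab) ᾱ (αᵢ bc) (αᵢ cd))

    -- β (T⁺ - T) = ℬ₂ Q - (α̂ β₄₅ + ᾱ β₁₂), with the subtractions moved across.
    gap : ∀ {x y Q T T⁺} → x + y ≈ Q →
          T ≈ α₁₂ + β₁₂ * x → T ≈ α₄₅ + β₄₅ * y → T⁺ ≈ α₁₃₅ + β₁₃₅ * Q →
          T * β + Q * ℬ₂ ≈ T⁺ * β + (α̂ * β₄₅ + ᾱ * β₁₂)
    gap {x} {y} {Q} {T} {T⁺} x+y≈Q T≈₁ T≈₂ T⁺≈ = begin
      T * β + Q * ℬ₂
        ≈⟨ +-congʳ (solve 5
             (λ t b₁ b₂ b₄ b₅ → t :* (b₁ :+ b₂ :+ b₄ :+ b₅)
                              := t :* (b₄ :+ b₅) :+ t :* (b₁ :+ b₂))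
             refl T (βᵢ ab) (βᵢ bd) (βᵢ ac) (βᵢ cd)) ⟩
      T * β₄₅ + T * β₁₂ + Q * ℬ₂
        -- The share `T * β₄₅` is evaluated along `P₁` and `T * β₁₂` along `P₂`, so `x` and `y` get
        -- the same coefficient `β₁₂ * β₄₅` and combine to `x + y`.
        ≈⟨ +-congʳ (+-cong (*-congʳ (trans T≈₁ (+-congʳ α₁₂≈α̂+α₁₃₅)))
                           (*-congʳ (trans T≈₂ (+-congʳ α₄₅≈ᾱ+α₁₃₅)))) ⟩
      (α̂ + α₁₃₅ + β₁₂ * x) * β₄₅ + (ᾱ + α₁₃₅ + β₄₅ * y) * β₁₂ + Q * ℬ₂
        ≈⟨ solve 9
             (λ h k a b d x y q s →
                 (h :+ a :+ b :* x) :* d :+ (k :+ a :+ d :* y) :* b :+ q :* s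
              := (a :* (d :+ b) :+ (h :* d :+ k :* b)) :+ ((x :+ y) :* (b :* d) :+ q :* s))
             refl α̂ ᾱ α₁₃₅ β₁₂ β₄₅ x y Q ℬ₂ ⟩
      α₁₃₅ * (β₄₅ + β₁₂) + R + ((x + y) * (β₁₂ * β₄₅) + Q * ℬ₂)
        -- Adding `β₁₂ * β₄₅` cancels the product subtracted in `ℬ₂`.
        ≈⟨ +-congˡ (trans (+-congʳ (*-congʳ x+y≈Q)) (trans (sym (distribˡ Q _ _))
             (*-congˡ (trans (+-comm _ _) (x-y+y≈x (β₁₂ * β₄₅) (β₁₃₅ * β)))))) ⟩
      α₁₃₅ * (β₄₅ + β₁₂) + R + Q * (β₁₃₅ * β)
        ≈⟨ solve 8
             (λ a r b₁ b₂ b₄ b₅ s q →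
                 a :* ((b₄ :+ b₅) :+ (b₁ :+ b₂)) :+ r :+ q :* (s :* (b₁ :+ b₂ :+ b₄ :+ b₅))
              := (a :+ s :* q) :* (b₁ :+ b₂ :+ b₄ :+ b₅) :+ r)
             refl α₁₃₅ R (βᵢ ab) (βᵢ bd) (βᵢ ac) (βᵢ cd) β₁₃₅ Q ⟩
      (α₁₃₅ + β₁₃₅ * Q) * β + R
        ≈⟨ +-congʳ (*-congʳ T⁺≈) ⟨
      T⁺ * β + R ∎
      where
      R : Carrier
      R = α̂ * β₄₅ + ᾱ * β₁₂

-- The paradox as a condition on the total flow.

theorem2 :
  ∀ {c ℓ₁ ℓ₂} (ℝ : Reals c ℓ₁ ℓ₂) →
  let open Reals ℝ
      open Traffic ℝ
  in
  (αᵢ βᵢ : Link → Carrier) →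
  (∀ l → 0# ≤ αᵢ l) →
  (βᵢ>0 : ∀ l → 0# < βᵢ l) →
  (Q : Carrier) → 0# < Q →
  let open Times αᵢ βᵢ
      open Positivity βᵢ>0
      open Flow
  in
  (f : Flow N Q) (T : Carrier) → IsEquilibrium f T →
  (f⁺ : Flow N⁺ Q) (T⁺ : Carrier) → IsEquilibrium f⁺ T⁺ →
  (∀ p → NonVanishing f p) →
  Vanishing f⁺ P₁ → Vanishing f⁺ P₂ → NonVanishing f⁺ P₃ →
  (T < T⁺)
    ⇔
  (Σ[ ℬ₂>0 ∈ 0# < ℬ₂ ]
    ( max (max (α / β₁₂ ⟨ β₁₂>0 ⟩) ((- α) / β₄₅ ⟨ β₄₅>0 ⟩))
          ((α̂ * β₄₅ + ᾱ * β₁₂) / ℬ₂ ⟨ ℬ₂>0 ⟩)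
        < Q
    × Q ≤ min (α̂ / β₃₅ ⟨ β₃₅>0 ⟩) (ᾱ / β₁₃ ⟨ β₁₃>0 ⟩)))
theorem2 ℝ αᵢ βᵢ _ βᵢ>0 Q 0<Q f T (used , _) f⁺ T⁺ (used⁺ , unused⁺)
  nonVanishing P₁≈0 P₂≈0 P₃#0 = mk⇔ to from
  where
  open Reals ℝ
  open Traffic ℝ
  open Times αᵢ βᵢ
  open Positivity βᵢ>0
  open Flow
  open OrderedField ℝ
  open Equilibria ℝ
  open Links αᵢ βᵢ

  R : Carrier
  R = α̂ * β₄₅ + ᾱ * β₁₂

  β>0 : 0# < β
  β>0 = +-pos (+-pos β₁₂>0 (βᵢ>0 ac)) (βᵢ>0 cd)

  amount>0 : ∀ p → 0# < amount f p
  amount>0 p = ≤∧#⇒< (nonNeg f p) (nonVanishing p)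

  T≈₁ : T ≈ α₁₂ + β₁₂ * amount f P₁
  T≈₁ = trans (sym (used P₁ (nonVanishing P₁))) (pathTime-N-P₁ f)

  T≈₂ : T ≈ α₄₅ + β₄₅ * amount f P₂
  T≈₂ = trans (sym (used P₂ (nonVanishing P₂))) (pathTime-N-P₂ f)

  T⁺≈ : T⁺ ≈ α₁₃₅ + β₁₃₅ * Q
  T⁺≈ = trans (sym (used⁺ P₃ P₃#0)) (pathTime-N⁺-P₃ f⁺ P₁≈0 P₂≈0)

  balanced : T * β + Q * ℬ₂ ≈ T⁺ * β + R
  balanced = gap (total-N f) T≈₁ T≈₂ T⁺≈

  α/β₁₂<Q : α / β₁₂ ⟨ β₁₂>0 ⟩ < Q
  α/β₁₂<Q = x<z*y⇒x/y<z β₁₂>0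
    (balanced-loads-bound β₁₂>0 β₄₅>0 (amount>0 P₂) (total-N f) (trans (sym T≈₁) T≈₂))

  -- The mirror image of the previous bound, with `P₁` and `P₂` exchanged; `- α` is rewritten as
  -- `α₁₂ - α₄₅` to fit.
  -α/β₄₅<Q : (- α) / β₄₅ ⟨ β₄₅>0 ⟩ < Q
  -α/β₄₅<Q = x<z*y⇒x/y<z β₄₅>0 (<-respˡ-≈ (sym (⁻¹-anti-homo‿- α₄₅ α₁₂))
    (balanced-loads-bound β₄₅>0 β₁₂>0 (amount>0 P₁)
      (trans (+-comm _ _) (total-N f)) (trans (sym T≈₂) T≈₁)))

  Qβ₃₅≤α̂ : Q * β₃₅ ≤ α̂
  Qβ₃₅≤α̂ = slack-bound (unused⁺ P₁ P₁≈0) T⁺≈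
    (trans (pathTime-N⁺-P₁ f⁺ P₁≈0 P₂≈0) (+-congʳ α₁₂≈α̂+α₁₃₅))
    (sym (+-assoc (βᵢ ab) (βᵢ bc) (βᵢ cd)))

  Qβ₁₃≤ᾱ : Q * β₁₃ ≤ ᾱ
  Qβ₁₃≤ᾱ = slack-bound (unused⁺ P₂ P₂≈0) T⁺≈
    (trans (pathTime-N⁺-P₂ f⁺ P₁≈0 P₂≈0) (+-congʳ α₄₅≈ᾱ+α₁₃₅))
    (+-comm (βᵢ cd) β₁₃)

  R>0 : 0# < R
  R>0 = +-pos (*-pos (<-≤-trans (*-pos 0<Q β₃₅>0) Qβ₃₅≤α̂) β₄₅>0)
              (*-pos (<-≤-trans (*-pos 0<Q β₁₃>0) Qβ₁₃≤ᾱ) β₁₂>0)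

  T<T⁺⇒R<Qℬ₂ : T < T⁺ → R < Q * ℬ₂
  T<T⁺⇒R<Qℬ₂ T<T⁺ = balance balanced (*-monoʳ-< β>0 T<T⁺)

  R<Qℬ₂⇒T<T⁺ : R < Q * ℬ₂ → T < T⁺
  R<Qℬ₂⇒T<T⁺ R<Qℬ₂ = *-cancelʳ-< β>0 (balance
    (trans (+-comm R (T⁺ * β)) (trans (sym balanced) (+-comm (T * β) (Q * ℬ₂)))) R<Qℬ₂)

  lower : 0# < ℬ₂ → Carrier
  lower ℬ₂>0 = max (max (α / β₁₂ ⟨ β₁₂>0 ⟩) ((- α) / β₄₅ ⟨ β₄₅>0 ⟩)) (R / ℬ₂ ⟨ ℬ₂>0 ⟩)

  upper : Carrier
  upper = min (α̂ / β₃₅ ⟨ β₃₅>0 ⟩) (ᾱ / β₁₃ ⟨ β₁₃>0 ⟩)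

  to : T < T⁺ → Σ[ ℬ₂>0 ∈ 0# < ℬ₂ ] (lower ℬ₂>0 < Q × Q ≤ upper)
  to T<T⁺ = ℬ₂>0
    , max-lub-< (max-lub-< α/β₁₂<Q -α/β₄₅<Q) (x<z*y⇒x/y<z ℬ₂>0 R<Qℬ₂)
    , proj₂ (proj₂ (min-infimum (α̂ / β₃₅ ⟨ β₃₅>0 ⟩) (ᾱ / β₁₃ ⟨ β₁₃>0 ⟩))) Q
        (z*y≤x⇒z≤x/y β₃₅>0 Qβ₃₅≤α̂) (z*y≤x⇒z≤x/y β₁₃>0 Qβ₁₃≤ᾱ)
    where
    R<Qℬ₂ : R < Q * ℬ₂
    R<Qℬ₂ = T<T⁺⇒R<Qℬ₂ T<T⁺

    ℬ₂>0 : 0# < ℬ₂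
    -- Cancels `Q` from `0# * Q < ℬ₂ * Q`, which holds since `0# < R < Q * ℬ₂`.
    ℬ₂>0 = *-cancelʳ-< 0<Q
      (<-respˡ-≈ (sym (zeroˡ Q)) (<-respʳ-≈ (*-comm Q ℬ₂) (<-trans R>0 R<Qℬ₂)))

  from : Σ[ ℬ₂>0 ∈ 0# < ℬ₂ ] (lower ℬ₂>0 < Q × Q ≤ upper) → T < T⁺
  -- The quotient of `R` by `ℬ₂` is at most the outer `max`, hence below `Q`; clearing the
  -- denominator gives `R < Q * ℬ₂`.
  from (ℬ₂>0 , lower<Q , _) = R<Qℬ₂⇒T<T⁺ (x/y<z⇒x<z*y ℬ₂>0
    (≤-<-trans (proj₁ (proj₂ (max-supremum
      (max (α / β₁₂ ⟨ β₁₂>0 ⟩) ((- α) / β₄₅ ⟨ β₄₅>0 ⟩)) (R / ℬ₂ ⟨ ℬ₂>0 ⟩)))) lower<Q))
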